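{- Let $S$ be a semigroup of transformations of a finite set $\Omega$ with $|\Omega|=n$, and suppose $S$ contains a permutation group $G$ that is primitive on $\Omega$. Suppose the minimum rank of an element of $S$ is $r$, where $r>1$. Then there is no element of $S$ of rank greater than $r$ whose kernel partition has $r-1$ parts of size $n/r$.
   Context: The rank of a transformation $h$ is $|\Omega h|$; its kernel partition is the partition of $\Omega$ into the inverse images of the points of its image. A permutation group is primitive if it is transitive and preserves no equivalence relation other than equality and the universal relation. -}

module Defs where

open import Data.Fin.Base using (Fin)
open import Data.Fin.Permutation using (Permutation′; _⟨$⟩ʳ_; _≈_; _∘ₚ_; flip; id)
open import Data.Fin.Properties using (_≟_; any?)
open import Data.Fin.Subset using (Subset; ∣_∣)
open import Data.Fin.Subset.Properties using (_∈?_)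
open import Data.List.Base using (List; map; filter; length; allFin)
open import Data.Nat.Base as ℕ using (ℕ; _*_)
import Data.Nat.Properties as ℕ
open import Data.Product.Base using (_×_; ∃-syntax)
open import Data.Sum.Base using (_⊎_)
open import Data.Vec.Base using (tabulate)
open import Function.Base using (_∘_)
open import Level using (Level; 0ℓ; _⊔_) renaming (suc to lsuc)
open import Relation.Binary.Core using (Rel; _⇒_)
open import Relation.Binary.Definitions using (Universal; _Respects_)
open import Relation.Binary.PropositionalEquality.Core using (_≡_; _≗_)
open import Relation.Binary.Structures using (IsDecEquivalence)
open import Relation.Nullary.Decidable using (does)
open import Relation.Unary using (Pred; _∈_)

private
  variable
    ℓ ℓ′ : Level
    n : ℕ

Transformation : ℕ → Set
Transformation n = Fin n → Fin n

image : Transformation n → Subset n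
image h = tabulate (λ y → does (any? (λ x → h x ≟ y)))

rank : Transformation n → ℕ
rank h = ∣ image h ∣

fibre : Transformation n → Fin n → Subset n
fibre h y = tabulate (λ x → does (h x ≟ y))

-- Restricting to points of the image makes every part nonempty, and
-- distinct points give disjoint parts, so nothing is listed twice.
kernelPartition : Transformation n → List (Subset n)
kernelPartition {n} h = map (fibre h) (filter (_∈? image h) (allFin n))

-- The number of kernel classes of size n / r.  The size condition is
-- written r * ∣ P ∣ ≡ n, so that it fails for every P when r does not
-- divide n (truncating division would not).
numParts-of-size-n/ : ℕ → Transformation n → ℕ
numParts-of-size-n/ {n} r h =
  length (filter (λ P → r * ∣ P ∣ ℕ.≟ n) (kernelPartition h))

-- A set of transformations is a predicate that cannot distinguish
-- pointwise equal functions; likewise for sets of permutations.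
record IsTransformationSemigroup {n} (S : Pred (Transformation n) ℓ) : Set ℓ where
  field
    respects : S Respects _≗_
    ∘-closed : ∀ {f g} → f ∈ S → g ∈ S → (g ∘ f) ∈ S

record IsPermutationGroup {n} (G : Pred (Permutation′ n) ℓ) : Set ℓ where
  field
    respects    : G Respects _≈_
    id-closed   : id ∈ G
    ∘ₚ-closed   : ∀ {π ρ} → π ∈ G → ρ ∈ G → (π ∘ₚ ρ) ∈ G
    flip-closed : ∀ {π} → π ∈ G → flip π ∈ G

_Contains_ : Pred (Transformation n) ℓ → Pred (Permutation′ n) ℓ′ → Set _
S Contains G = ∀ {π} → π ∈ G → (π ⟨$⟩ʳ_) ∈ S

Transitive : Pred (Permutation′ n) ℓ → Set ℓ
Transitive G = ∀ x y → ∃[ π ] (π ∈ G × π ⟨$⟩ʳ x ≡ y)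

Preserves : Pred (Permutation′ n) ℓ → Rel (Fin n) ℓ′ → Set _
Preserves G _∼_ = ∀ {π} → π ∈ G → ∀ {x y} → x ∼ y → (π ⟨$⟩ʳ x) ∼ (π ⟨$⟩ʳ y)

-- Equivalence relations on a finite set are taken to be decidable.  As
-- this is a hypothesis, quantifying over all relations would demand more:
-- applied to x ≡ y ⊎ P, it would decide an arbitrary proposition P as
-- soon as 1 < n.
record Primitive {n} (G : Pred (Permutation′ n) ℓ) : Set (ℓ ⊔ lsuc 0ℓ) where
  field
    transitive    : Transitive G
    no-congruence : ∀ {_∼_ : Rel (Fin n) 0ℓ} → IsDecEquivalence _∼_ →
                    Preserves G _∼_ → (_∼_ ⇒ _≡_) ⊎ Universal _∼_

record IsMinimumRank {n} (S : Pred (Transformation n) ℓ) (r : ℕ) : Set ℓ where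
  field
    attained : ∃[ f ] (f ∈ S × rank f ≡ r)
    minimal  : ∀ {f} → f ∈ S → r ℕ.≤ rank f

-- Call g ∈ S minimal if its rank is r; every s ∈ S is injective on the image
-- of a minimal g, since s ∘ g has rank r again.  Averaging over the transitive
-- group G, a kernel class of size n / r of h ∈ S meets the image of every
-- minimal element (the clique–coclique argument).  So if T is the set of values
-- of the classes of h of size n / r, then T ⊆ image (h ∘ g) for all minimal g.
-- If ∣ T ∣ ≥ r − 1 and rank h > r, there are distinct c₁, c₂ and minimal g₁, g₂
-- with image (h ∘ gᵢ) = T ∪ {cᵢ}.  Every minimal g is injective on both sets and
-- maps both onto its image, hence g c₁ = g c₂.  But "all minimal g agree on x and
-- y" is a G-invariant equivalence relation, and it is not universal as r > 1, so
-- primitivity gives c₁ = c₂.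
module Submission where

open import Defs
open import Data.Bool.Base using (true; false; if_then_else_)
open import Data.Fin.Base using (Fin; zero; suc; finToFun; funToFin; combine)
open import Data.Fin.Permutation
  using (Permutation′; permutation; _⟨$⟩ʳ_; _⟨$⟩ˡ_; inverseʳ; inverseˡ; _∘ₚ_; flip; id)
open import Data.Fin.Properties
  using (_≟_; any?; sequence; funToFin-finToFin; finToFun-funToFin; nonZeroIndex)
open import Data.Fin.Subset using (Subset; ∣_∣; ⊥; _∪_; _∩_; _-_; ⁅_⁆; _⊆_; Nonempty)
  renaming (_∈_ to _∈ₛ_; _∉_ to _∉ₛ_)
open import Data.Fin.Subset.Properties
open import Data.List.Base as List using (filter; length)
open import Data.Nat.Base using (ℕ; zero; suc; _+_; _*_; _^_; _∸_; _≤_; _<_; z≤n; s≤s)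
open import Data.Nat.Properties as ℕ hiding (_≟_)
open import Data.Product.Base using (_×_; _,_; proj₁; proj₂; ∃-syntax)
open import Data.Sum.Base using (inj₁; inj₂)
open import Data.Vec.Base using (tabulate; _∷_; [])
open import Data.Vec.Properties using (lookup∘tabulate; []=⇒lookup; lookup⇒[]=)
open import Effect.Monad using (RawMonad)
open import Function.Base using (_∘_; case_of_)
open import Level using (Level)
open import Relation.Binary.Core using (Rel)
open import Relation.Binary.PropositionalEquality
open import Relation.Binary.Structures using (IsDecEquivalence)
open import Relation.Nullary.Decidable
open import Relation.Nullary.Negation using (¬_; contradiction; ¬¬-Monad)
open import Relation.Unary using (Pred; _∈_; Decidable)

open import Algebra.Properties.CommutativeSemigroup *-commutativeSemigroup using (x∙yz≈y∙xz)
open import Algebra.Properties.Semiring.Sum +-*-semiring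

private
  variable
    a b p : Level
    A : Set a
    B : Set b
    m n : ℕ

-- Double negation, tabulated subsets and counting by lists.

¬¬-decidable : (P : Pred (Fin n) p) → ¬ ¬ Decidable P
¬¬-decidable P = sequence (RawMonad.rawApplicative ¬¬-Monad) (λ i → ¬¬-excluded-middle)

module _ {P : Pred (Fin n) p} (P? : Decidable P) where

  ∈-tabulate⁺ : ∀ {x} → P x → x ∈ₛ tabulate (does ∘ P?)
  ∈-tabulate⁺ {x} Px =
    lookup⇒[]= x _ (trans (lookup∘tabulate (does ∘ P?) x) (dec-true (P? x) Px))

  ∈-tabulate⁻ : ∀ {x} → x ∈ₛ tabulate (does ∘ P?) → P x
  ∈-tabulate⁻ {x} x∈ with P? x | trans (sym (lookup∘tabulate (does ∘ P?) x)) ([]=⇒lookup x∈)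
  ... | yes Px | _ = Px
  ... | no _   | ()

∈-image⁺ : (h : Transformation n) → ∀ x → h x ∈ₛ image h
∈-image⁺ h x = ∈-tabulate⁺ (λ y → any? (λ x → h x ≟ y)) (x , refl)

∈-image⁻ : (h : Transformation n) → ∀ {y} → y ∈ₛ image h → ∃[ x ] h x ≡ y
∈-image⁻ h = ∈-tabulate⁻ (λ y → any? (λ x → h x ≟ y))

-- Turns the number of kernel classes of a given size into the cardinality of the set of their
-- values. The enumeration `g` is arbitrary so that the induction can pass to `g ∘ suc`; `allFin` is
-- the case where `g` is the identity.
length-filter-map-filter :
  ∀ {P : Pred B p} {Q : Pred A a} (P? : Decidable P) (Q? : Decidable Q) (f : A → B) (g : Fin n → A) →
  length (filter P? (List.map f (filter Q? (List.tabulate g))))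
    ≡ ∣ tabulate (λ i → does (Q? (g i) ×-dec P? (f (g i)))) ∣
length-filter-map-filter {n = zero} P? Q? f g = refl
length-filter-map-filter {n = suc n} P? Q? f g with does (Q? (g zero))
... | false = length-filter-map-filter P? Q? f (g ∘ suc)
... | true with does (P? (f (g zero)))
...   | true  = cong suc (length-filter-map-filter P? Q? f (g ∘ suc))
...   | false = length-filter-map-filter P? Q? f (g ∘ suc)

-- Indicators, finite sums and cardinalities.

𝟙 : Dec A → ℕ
𝟙 a? = if does a? then 1 else 0

𝟙-true : (a? : Dec A) → A → 𝟙 a? ≡ 1
𝟙-true a? x rewrite dec-true a? x = refl

𝟙-false : (a? : Dec A) → ¬ A → 𝟙 a? ≡ 0
𝟙-false a? x rewrite dec-false a? x = refl

𝟙-⇔ : (a? : Dec A) (b? : Dec B) → (A → B) → (B → A) → 𝟙 a? ≡ 𝟙 b?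
𝟙-⇔ a? (yes y) f g = 𝟙-true a? (g y)
𝟙-⇔ a? (no ¬y) f g = 𝟙-false a? (¬y ∘ f)

𝟙-× : (a? : Dec A) (b? : Dec B) → 𝟙 (a? ×-dec b?) ≡ 𝟙 a? * 𝟙 b?
𝟙-× (yes _) b? = sym (+-identityʳ (𝟙 b?))
𝟙-× (no _)  b? = refl

sum-mono : {f g : Fin n → ℕ} → (∀ i → f i ≤ g i) → sum f ≤ sum g
sum-mono {zero} le = z≤n
sum-mono {suc n} le = +-mono-≤ (le zero) (sum-mono (le ∘ suc))

term≤sum : (f : Fin n → ℕ) (i : Fin n) → f i ≤ sum f
term≤sum f zero = m≤m+n _ _
term≤sum f (suc i) = ≤-trans (term≤sum (f ∘ suc) i) (m≤n+m _ _)

sum-mono-< : {f g : Fin n → ℕ} → (∀ i → f i ≤ g i) → ∀ i → f i < g i → sum f < sum g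
sum-mono-< le zero lt = +-mono-<-≤ lt (sum-mono (le ∘ suc))
sum-mono-< le (suc i) lt = +-mono-≤-< (le zero) (sum-mono-< (le ∘ suc) i lt)

sum-zero : {f : Fin n → ℕ} → (∀ i → f i ≡ 0) → sum f ≡ 0
sum-zero {n} f≡0 = trans (sum-cong-≗ f≡0) (sum-replicate-zero n)

sum-const : ∀ n c → ∑[ i < n ] c ≡ n * c
sum-const zero    c = refl
sum-const (suc n) c = cong (c +_) (sum-const n c)

sum-𝟙-≟ : (x : Fin n) (g : Fin n → ℕ) → ∑[ y < n ] (𝟙 (x ≟ y) * g y) ≡ g x
sum-𝟙-≟ {suc n} zero g = trans (cong₂ _+_ (+-identityʳ (g zero)) (sum-replicate-zero n)) (+-identityʳ _)
sum-𝟙-≟ {suc n} (suc x) g = sum-𝟙-≟ x (g ∘ suc)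

sum-𝟙-≤1 : {P : Pred (Fin n) p} (P? : Decidable P) →
           (∀ {x y} → P x → P y → x ≡ y) → ∑[ x < n ] 𝟙 (P? x) ≤ 1
sum-𝟙-≤1 {n} P? unique with any? P?
... | no ∄ = ≤-trans (≤-reflexive (sum-zero λ x → 𝟙-false (P? x) (λ Px → ∄ (x , Px)))) z≤n
... | yes (x₀ , Px₀) = begin
    ∑[ x < n ] 𝟙 (P? x)              ≤⟨ sum-mono below ⟩
    ∑[ x < n ] (𝟙 (x₀ ≟ x) * 1)      ≡⟨ sum-𝟙-≟ x₀ (λ _ → 1) ⟩
    1                                ∎
  where
  open ≤-Reasoning
  below : ∀ x → 𝟙 (P? x) ≤ 𝟙 (x₀ ≟ x) * 1
  below x with P? x
  ... | no _ = z≤n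
  ... | yes Px = ≤-reflexive (sym (trans (*-identityʳ _) (𝟙-true (x₀ ≟ x) (unique Px₀ Px))))

∣_∣-sum : (q : Subset n) → ∣ q ∣ ≡ ∑[ x < n ] 𝟙 (x ∈? q)
∣ [] ∣-sum = refl
∣ true ∷ q ∣-sum = cong suc ∣ q ∣-sum
∣ false ∷ q ∣-sum = ∣ q ∣-sum

-- Double counting of the pairs `s x ≡ y` with `x` in `p`: each `y` in `q` occurs in at least one,
-- and each `x` in `p` in exactly one.
covered⇒∣q∣≤∣p∣ : (s : Transformation n) (p q : Subset n) →
                  (∀ {y} → y ∈ₛ q → ∃[ x ] (x ∈ₛ p × s x ≡ y)) → ∣ q ∣ ≤ ∣ p ∣
covered⇒∣q∣≤∣p∣ {n} s p q cover = begin
  ∣ q ∣                                              ≡⟨ ∣ q ∣-sum ⟩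
  ∑[ y < n ] 𝟙 (y ∈? q)                              ≤⟨ sum-mono below ⟩
  ∑[ y < n ] ∑[ x < n ] (𝟙 (s x ≟ y) * 𝟙 (x ∈? p))   ≡⟨ ∑-comm (λ y x → 𝟙 (s x ≟ y) * 𝟙 (x ∈? p)) ⟩
  ∑[ x < n ] ∑[ y < n ] (𝟙 (s x ≟ y) * 𝟙 (x ∈? p))   ≡⟨ sum-cong-≗ (λ x → sum-𝟙-≟ (s x) (λ _ → 𝟙 (x ∈? p))) ⟩
  ∑[ x < n ] 𝟙 (x ∈? p)                              ≡⟨ ∣ p ∣-sum ⟨
  ∣ p ∣                                              ∎
  where
  open ≤-Reasoning
  below : ∀ y → 𝟙 (y ∈? q) ≤ ∑[ x < n ] (𝟙 (s x ≟ y) * 𝟙 (x ∈? p))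
  below y with y ∈? q
  ... | no _ = z≤n
  ... | yes y∈q with x , x∈p , eq ← cover y∈q = begin
    1                              ≡⟨ cong₂ _*_ (𝟙-true (s x ≟ y) eq) (𝟙-true (x ∈? p) x∈p) ⟨
    𝟙 (s x ≟ y) * 𝟙 (x ∈? p)       ≤⟨ term≤sum (λ x → 𝟙 (s x ≟ y) * 𝟙 (x ∈? p)) x ⟩
    ∑[ x < n ] (𝟙 (s x ≟ y) * 𝟙 (x ∈? p)) ∎

-- Transformations coded as elements of a finite set.

funToFin-cong : {f g : Fin m → Fin n} → f ≗ g → funToFin f ≡ funToFin g
funToFin-cong {m = zero} f≗g = refl
funToFin-cong {m = suc m} f≗g = cong₂ combine (f≗g zero) (funToFin-cong (f≗g ∘ suc))

module _ {n : ℕ} where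

  decode : Fin (n ^ n) → Transformation n
  decode = finToFun

  encode : Transformation n → Fin (n ^ n)
  encode = funToFin

  decode-encode : ∀ f → decode (encode f) ≗ f
  decode-encode = finToFun-funToFin

  encode-decode : ∀ i → encode (decode i) ≡ i
  encode-decode = funToFin-finToFin {n} {n}

  -- Packaged as a permutation of codes so that `sum-permute` can reindex sums over a group by left
  -- multiplication.
  postcompose : Permutation′ n → Permutation′ (n ^ n)
  postcompose σ = permutation (act (σ ⟨$⟩ʳ_)) (act (σ ⟨$⟩ˡ_))
    (cancel (σ ⟨$⟩ʳ_) (σ ⟨$⟩ˡ_) (λ _ → inverseʳ σ)) (cancel (σ ⟨$⟩ˡ_) (σ ⟨$⟩ʳ_) (λ _ → inverseˡ σ))
    where
    act : Transformation n → Fin (n ^ n) → Fin (n ^ n)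
    act f i = encode (f ∘ decode i)
    cancel : ∀ f g → (∀ x → f (g x) ≡ x) → ∀ i → act f (act g i) ≡ i
    cancel f g fg i = trans
      (funToFin-cong {n} {n} (λ x → trans (cong f (decode-encode (g ∘ decode i) x)) (fg _)))
      (encode-decode i)

  decode-postcompose : ∀ σ i x → decode (postcompose σ ⟨$⟩ʳ i) x ≡ σ ⟨$⟩ʳ decode i x
  decode-postcompose σ i = decode-encode ((σ ⟨$⟩ʳ_) ∘ decode i)

  -- Averaging over a transitive group.

  module _ {ℓ} {G : Pred (Permutation′ n) ℓ} (isGroup : IsPermutationGroup G) (transitive : Transitive G) where

    open IsPermutationGroup isGroup

    -- Membership in G need not be decidable, but G is a subset of a finite set, so
    -- it is not not decidable; that suffices for the stable conclusion below.
    Enumerated : Pred (Fin (n ^ n)) ℓ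
    Enumerated i = ∃[ π ] (π ∈ G × (π ⟨$⟩ʳ_) ≗ decode i)

    postcompose-Enumerated⁺ : ∀ {σ} → σ ∈ G → ∀ {i} → Enumerated i → Enumerated (postcompose σ ⟨$⟩ʳ i)
    postcompose-Enumerated⁺ {σ} σ∈G {i} (π , π∈G , π≗) =
      π ∘ₚ σ , ∘ₚ-closed π∈G σ∈G ,
      λ x → trans (cong (σ ⟨$⟩ʳ_) (π≗ x)) (sym (decode-postcompose σ i x))

    postcompose-Enumerated⁻ : ∀ {σ} → σ ∈ G → ∀ {i} → Enumerated (postcompose σ ⟨$⟩ʳ i) → Enumerated i
    postcompose-Enumerated⁻ {σ} σ∈G {i} (π , π∈G , π≗) =
      π ∘ₚ flip σ , ∘ₚ-closed π∈G (flip-closed σ∈G) ,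
      λ x → trans (cong (σ ⟨$⟩ˡ_) (trans (π≗ x) (decode-postcompose σ i x))) (inverseˡ σ)

    module _ (enumerated? : Decidable Enumerated) where

      weight : Fin (n ^ n) → ℕ
      weight i = 𝟙 (enumerated? i)

      -- The size of a coset of the stabiliser of `x`; correspondingly `sum weight` is the order of
      -- `G`, counting pointwise equal permutations once.
      hits : Fin n → Fin n → ℕ
      hits x y = ∑[ i < n ^ n ] (𝟙 (decode i x ≟ y) * weight i)

      -- Left multiplication by `σ` is a bijection from the elements of `G` sending `x` to `y` onto
      -- those sending `x` to `σ ⟨$⟩ʳ y`.
      hits-image : ∀ {σ} → σ ∈ G → ∀ x y → hits x (σ ⟨$⟩ʳ y) ≡ hits x y
      hits-image {σ} σ∈G x y = trans
        (sum-permute (λ i → 𝟙 (decode i x ≟ σ ⟨$⟩ʳ y) * weight i) (postcompose σ))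
        (sum-cong-≗ λ i → cong₂ _*_
          (𝟙-⇔ (decode (postcompose σ ⟨$⟩ʳ i) x ≟ σ ⟨$⟩ʳ y) (decode i x ≟ y)
            (λ eq → trans (sym (inverseˡ σ))
              (trans (cong (σ ⟨$⟩ˡ_) (trans (sym (decode-postcompose σ i x)) eq)) (inverseˡ σ)))
            (λ eq → trans (decode-postcompose σ i x) (cong (σ ⟨$⟩ʳ_) eq)))
          (𝟙-⇔ (enumerated? (postcompose σ ⟨$⟩ʳ i)) (enumerated? i)
            (postcompose-Enumerated⁻ σ∈G) (postcompose-Enumerated⁺ σ∈G)))

      hits-constant : ∀ x y z → hits x y ≡ hits x z
      hits-constant x y z with σ , σ∈G , refl ← transitive z y = hits-image σ∈G x z

      -- Orbit-stabiliser: every group element sends `x` to exactly one point, and all `n` points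
      -- are hit equally often.
      n*hits : ∀ x y → n * hits x y ≡ sum weight
      n*hits x y = begin
        n * hits x y                 ≡⟨ sum-const n (hits x y) ⟨
        ∑[ z < n ] hits x y          ≡⟨ sum-cong-≗ (hits-constant x y) ⟩
        ∑[ z < n ] hits x z          ≡⟨ ∑-comm (λ z i → 𝟙 (decode i x ≟ z) * weight i) ⟩
        ∑[ i < n ^ n ] ∑[ z < n ] (𝟙 (decode i x ≟ z) * weight i)
                                     ≡⟨ sum-cong-≗ (λ i → sum-𝟙-≟ (decode i x) (λ _ → weight i)) ⟩
        sum weight                   ∎
        where open ≡-Reasoning

      n*hits-subset : ∀ (A : Subset n) x →
        n * ∑[ i < n ^ n ] (𝟙 (decode i x ∈? A) * weight i) ≡ ∣ A ∣ * sum weight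
      n*hits-subset A x = begin
        n * ∑[ i < n ^ n ] (𝟙 (decode i x ∈? A) * weight i)
          ≡⟨ cong (n *_) (sum-cong-≗ λ i → sym (sum-𝟙-≟ (decode i x) (λ y → 𝟙 (y ∈? A) * weight i))) ⟩
        n * ∑[ i < n ^ n ] ∑[ y < n ] (𝟙 (decode i x ≟ y) * (𝟙 (y ∈? A) * weight i))
          ≡⟨ cong (n *_) (∑-comm (λ i y → 𝟙 (decode i x ≟ y) * (𝟙 (y ∈? A) * weight i))) ⟩
        n * ∑[ y < n ] ∑[ i < n ^ n ] (𝟙 (decode i x ≟ y) * (𝟙 (y ∈? A) * weight i))
          ≡⟨ cong (n *_) (sum-cong-≗ λ y → trans
               (sum-cong-≗ λ i → x∙yz≈y∙xz (𝟙 (decode i x ≟ y)) (𝟙 (y ∈? A)) (weight i))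
               (sym (*-distribˡ-sum (𝟙 (y ∈? A)) (λ i → 𝟙 (decode i x ≟ y) * weight i)))) ⟩
        n * ∑[ y < n ] (𝟙 (y ∈? A) * hits x y)
          ≡⟨ *-distribˡ-sum n (λ y → 𝟙 (y ∈? A) * hits x y) ⟩
        ∑[ y < n ] (n * (𝟙 (y ∈? A) * hits x y))
          ≡⟨ sum-cong-≗ (λ y → trans (x∙yz≈y∙xz n (𝟙 (y ∈? A)) (hits x y)) (cong (𝟙 (y ∈? A) *_) (n*hits x y))) ⟩
        ∑[ y < n ] (𝟙 (y ∈? A) * sum weight)
          ≡⟨ *-distribʳ-sum (sum weight) (λ y → 𝟙 (y ∈? A)) ⟨
        (∑[ y < n ] 𝟙 (y ∈? A)) * sum weight
          ≡⟨ cong (_* sum weight) ∣ A ∣-sum ⟨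
        ∣ A ∣ * sum weight ∎
        where open ≡-Reasoning

      module _ (K A : Subset n) where

        meeting : Fin (n ^ n) → ℕ
        meeting i = ∑[ x < n ] (𝟙 (x ∈? K) * 𝟙 (decode i x ∈? A))

        -- Linearity of expectation: a random element of `G` sends each point of `K` into `A` with
        -- probability `∣ A ∣` over `n`.
        n*sum-meeting : n * ∑[ i < n ^ n ] (meeting i * weight i) ≡ (∣ K ∣ * ∣ A ∣) * sum weight
        n*sum-meeting = begin
          n * ∑[ i < n ^ n ] (meeting i * weight i)
            ≡⟨ cong (n *_) (sum-cong-≗ λ i → trans
                 (*-distribʳ-sum (weight i) (λ x → 𝟙 (x ∈? K) * 𝟙 (decode i x ∈? A)))
                 (sum-cong-≗ λ x → *-assoc (𝟙 (x ∈? K)) (𝟙 (decode i x ∈? A)) (weight i))) ⟩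
          n * ∑[ i < n ^ n ] ∑[ x < n ] (𝟙 (x ∈? K) * (𝟙 (decode i x ∈? A) * weight i))
            ≡⟨ cong (n *_) (∑-comm (λ i x → 𝟙 (x ∈? K) * (𝟙 (decode i x ∈? A) * weight i))) ⟩
          n * ∑[ x < n ] ∑[ i < n ^ n ] (𝟙 (x ∈? K) * (𝟙 (decode i x ∈? A) * weight i))
            ≡⟨ cong (n *_) (sum-cong-≗ λ x →
                 sym (*-distribˡ-sum (𝟙 (x ∈? K)) (λ i → 𝟙 (decode i x ∈? A) * weight i))) ⟩
          n * ∑[ x < n ] (𝟙 (x ∈? K) * ∑[ i < n ^ n ] (𝟙 (decode i x ∈? A) * weight i))
            ≡⟨ *-distribˡ-sum n (λ x → 𝟙 (x ∈? K) * ∑[ i < n ^ n ] (𝟙 (decode i x ∈? A) * weight i)) ⟩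
          ∑[ x < n ] (n * (𝟙 (x ∈? K) * ∑[ i < n ^ n ] (𝟙 (decode i x ∈? A) * weight i)))
            ≡⟨ sum-cong-≗ (λ x → trans
                 (x∙yz≈y∙xz n (𝟙 (x ∈? K)) (∑[ i < n ^ n ] (𝟙 (decode i x ∈? A) * weight i)))
                 (cong (𝟙 (x ∈? K) *_) (n*hits-subset A x))) ⟩
          ∑[ x < n ] (𝟙 (x ∈? K) * (∣ A ∣ * sum weight))
            ≡⟨ *-distribʳ-sum (∣ A ∣ * sum weight) (λ x → 𝟙 (x ∈? K)) ⟨
          (∑[ x < n ] 𝟙 (x ∈? K)) * (∣ A ∣ * sum weight)
            ≡⟨ cong (_* (∣ A ∣ * sum weight)) ∣ K ∣-sum ⟨
          ∣ K ∣ * (∣ A ∣ * sum weight)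
            ≡⟨ *-assoc ∣ K ∣ ∣ A ∣ (sum weight) ⟨
          (∣ K ∣ * ∣ A ∣) * sum weight ∎
          where open ≡-Reasoning

        module _
          (atMostOne : ∀ {π} → π ∈ G → ∀ {x y} → x ∈ₛ K → y ∈ₛ K →
                       π ⟨$⟩ʳ x ∈ₛ A → π ⟨$⟩ʳ y ∈ₛ A → x ≡ y)
          where

          both? : ∀ i → Decidable (λ x → x ∈ₛ K × decode i x ∈ₛ A)
          both? i x = (x ∈? K) ×-dec (decode i x ∈? A)

          meeting-𝟙 : ∀ i → meeting i ≡ ∑[ x < n ] 𝟙 (both? i x)
          meeting-𝟙 i = sum-cong-≗ λ x → sym (𝟙-× (x ∈? K) (decode i x ∈? A))

          meeting≤1 : ∀ {i} → Enumerated i → meeting i ≤ 1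
          meeting≤1 {i} (π , π∈G , π≗) = subst (_≤ 1) (sym (meeting-𝟙 i))
            (sum-𝟙-≤1 (both? i) λ (x∈K , Fx∈A) (y∈K , Fy∈A) →
              atMostOne π∈G x∈K y∈K (subst (_∈ₛ A) (sym (π≗ _)) Fx∈A) (subst (_∈ₛ A) (sym (π≗ _)) Fy∈A))

          meeting*weight≤weight : ∀ i → meeting i * weight i ≤ weight i
          meeting*weight≤weight i with enumerated? i
          ... | no _  = ≤-reflexive (*-zeroʳ (meeting i))
          ... | yes e = *-monoˡ-≤ 1 (meeting≤1 e)

          -- No term exceeds its weight, and the term of the identity, coded by `i₀`, is 0 while its
          -- weight is 1.
          disjoint⇒sum< : ¬ Nonempty (K ∩ A) → ∑[ i < n ^ n ] (meeting i * weight i) < sum weight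
          disjoint⇒sum< disjoint =
            sum-mono-< meeting*weight≤weight i₀ (subst₂ _<_
              (sym (cong (_* weight i₀) meeting≡0))
              (sym (𝟙-true (enumerated? i₀) (id , id-closed , sym ∘ decode-encode _)))
              (s≤s z≤n))
            where
            i₀ = encode (λ x → x)
            meeting≡0 : meeting i₀ ≡ 0
            meeting≡0 = trans (meeting-𝟙 i₀) (sum-zero λ x → 𝟙-false (both? i₀ x) λ (x∈K , Fx∈A) →
              disjoint (x , x∈p∩q⁺ (x∈K , subst (_∈ₛ A) (decode-encode _ x) Fx∈A)))

    -- The average number of points of `K` sent into `A` is exactly 1 and no group element sends
    -- more than one, so none sends fewer; the identity then yields a common point.
    clique-coclique : (K A : Subset n) → ∣ K ∣ * ∣ A ∣ ≡ n → Nonempty K →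
      (∀ {π} → π ∈ G → ∀ {x y} → x ∈ₛ K → y ∈ₛ K → π ⟨$⟩ʳ x ∈ₛ A → π ⟨$⟩ʳ y ∈ₛ A → x ≡ y) →
      Nonempty (K ∩ A)
    clique-coclique K A size (x₀ , _) atMostOne =
      decidable-stable (nonempty? (K ∩ A)) λ disjoint → ¬¬-decidable Enumerated λ enumerated? →
        <⇒≢ (disjoint⇒sum< enumerated? K A atMostOne disjoint)
          -- The point `x₀` witnesses that `n` is nonzero, so it can be cancelled.
          (*-cancelˡ-≡ _ _ n {{nonZeroIndex x₀}}
            (trans (n*sum-meeting enumerated? K A) (cong (_* sum (weight enumerated?)) size)))

-- Subsets, images and ranks of composites.

∣p∣<∣q∣⇒∃∈∉ : (p q : Subset n) → ∣ p ∣ < ∣ q ∣ → ∃[ x ] (x ∈ₛ q × x ∉ₛ p)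
∣p∣<∣q∣⇒∃∈∉ p q lt with any? (λ x → (x ∈? q) ×-dec ¬? (x ∈? p))
... | yes found = found
... | no none = contradiction
  (p⊆q⇒∣p∣≤∣q∣ λ {x} x∈q → decidable-stable (x ∈? p) λ x∉p → none (x , x∈q , x∉p)) (<⇒≱ lt)

p⊆q∧∣q∣≤∣p∣⇒q⊆p : {p q : Subset n} → p ⊆ q → ∣ q ∣ ≤ ∣ p ∣ → q ⊆ p
p⊆q∧∣q∣≤∣p∣⇒q⊆p {p = p} p⊆q le {x} x∈q =
  decidable-stable (x ∈? p) λ x∉p → <⇒≱ (p⊂q⇒∣p∣<∣q∣ (p⊆q , x , x∈q , x∉p)) le

∪⁅⁆-⊆ : {p q : Subset n} {x : Fin n} → p ⊆ q → x ∈ₛ q → p ∪ ⁅ x ⁆ ⊆ q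
∪⁅⁆-⊆ {p = p} {q} {x} p⊆q x∈q y∈ with x∈p∪q⁻ p ⁅ x ⁆ y∈
... | inj₁ y∈p = p⊆q y∈p
... | inj₂ y∈x = subst (_∈ₛ q) (sym (x∈⁅y⁆⇒x≡y x y∈x)) x∈q

∣∪⁅⁆∣ : {p : Subset n} {x : Fin n} → x ∉ₛ p → ∣ p ∣ < ∣ p ∪ ⁅ x ⁆ ∣
∣∪⁅⁆∣ {p = p} {x} x∉p =
  p⊂q⇒∣p∣<∣q∣ (p⊆p∪q ⁅ x ⁆ , x , q⊆p∪q p ⁅ x ⁆ (x∈⁅x⁆ x) , x∉p)

image-∘-⊆ : (f g : Transformation n) → image (f ∘ g) ⊆ image f
image-∘-⊆ f g y∈ with x , refl ← ∈-image⁻ (f ∘ g) y∈ = ∈-image⁺ f (g x)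

rank-∘-≤ˡ : (f g : Transformation n) → rank (f ∘ g) ≤ rank f
rank-∘-≤ˡ f g = p⊆q⇒∣p∣≤∣q∣ (image-∘-⊆ f g)

rank-∘-≤ʳ : (f g : Transformation n) → rank (f ∘ g) ≤ rank g
rank-∘-≤ʳ f g = covered⇒∣q∣≤∣p∣ f (image g) (image (f ∘ g)) λ y∈ →
  let x , eq = ∈-image⁻ (f ∘ g) y∈ in g x , ∈-image⁺ g x , eq

-- If `f` merged distinct points `x` and `y` of `image g`, then `image g - x` would still be mapped
-- onto `image (f ∘ g)`, with `y` replacing `x`, and the rank would drop.
rank-∘≡⇒injective : (f g : Transformation n) → rank (f ∘ g) ≡ rank g →
  ∀ {x y} → x ∈ₛ image g → y ∈ₛ image g → f x ≡ f y → x ≡ y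
rank-∘≡⇒injective f g same {x} {y} x∈ y∈ fx≡fy = decidable-stable (x ≟ y) λ x≢y →
  <⇒≱ (x∈p⇒∣p-x∣<∣p∣ x∈) (subst (_≤ ∣ image g - x ∣) same
    (covered⇒∣q∣≤∣p∣ f (image g - x) (image (f ∘ g)) λ z∈ → avoid x≢y (∈-image⁻ (f ∘ g) z∈)))
  where
  avoid : x ≢ y → ∀ {z} → ∃[ u ] f (g u) ≡ z → ∃[ v ] (v ∈ₛ image g - x × f v ≡ z)
  avoid x≢y (u , refl) with g u ≟ x
  ... | yes refl = y , x∈p∧x≢y⇒x∈p-y y∈ (x≢y ∘ sym) , sym fx≡fy
  ... | no gu≢x  = g u , x∈p∧x≢y⇒x∈p-y (∈-image⁺ g u) gu≢x , refl

constant⇒rank≤1 : (f : Transformation n) → (∀ x y → f x ≡ f y) → rank f ≤ 1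
constant⇒rank≤1 {n} f const = ≮⇒≥ λ 1<rank →
  let y , y∈ , _ = ∣p∣<∣q∣⇒∃∈∉ ⊥ (image f) (subst (_< rank f) (sym (∣⊥∣≡0 n)) (<-trans (s≤s z≤n) 1<rank))
      z , z∈ , z∉ = ∣p∣<∣q∣⇒∃∈∉ ⁅ y ⁆ (image f) (subst (_< rank f) (sym (∣⁅x⁆∣≡1 y)) 1<rank)
      u , fu≡y = ∈-image⁻ f y∈
      v , fv≡z = ∈-image⁻ f z∈
  in z∉ (subst (_∈ₛ ⁅ y ⁆) (trans (sym fu≡y) (trans (const u v) fv≡z)) (x∈⁅x⁆ y))

-- Elements of minimum rank.

module _ {ℓ r} {S : Pred (Transformation n) ℓ}
  (isSemigroup : IsTransformationSemigroup S) (isMinimumRank : IsMinimumRank S r) where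

  open IsTransformationSemigroup isSemigroup
  open IsMinimumRank isMinimumRank

  Minimal : Pred (Transformation n) ℓ
  Minimal g = g ∈ S × rank g ≡ r

  Minimal-∘ˡ : ∀ {s g} → s ∈ S → Minimal g → Minimal (s ∘ g)
  Minimal-∘ˡ {s} {g} s∈S (g∈S , refl) =
    ∘-closed g∈S s∈S , ≤-antisym (rank-∘-≤ʳ s g) (minimal (∘-closed g∈S s∈S))

  Minimal-∘ʳ : ∀ {g s} → Minimal g → s ∈ S → Minimal (g ∘ s)
  Minimal-∘ʳ {g} {s} (g∈S , refl) s∈S =
    ∘-closed s∈S g∈S , ≤-antisym (rank-∘-≤ˡ g s) (minimal (∘-closed s∈S g∈S))

  injective-on-image : ∀ {s g} → s ∈ S → Minimal g →
    ∀ {x y} → x ∈ₛ image g → y ∈ₛ image g → s x ≡ s y → x ≡ y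
  injective-on-image {s} {g} s∈S g-min =
    rank-∘≡⇒injective s g (trans (proj₂ (Minimal-∘ˡ s∈S g-min)) (sym (proj₂ g-min)))

  -- The reverse inclusion always holds, and both images have `r` points.
  image-⊆-image-∘ : ∀ {g s} → Minimal g → s ∈ S → image g ⊆ image (g ∘ s)
  image-⊆-image-∘ {g} {s} g-min s∈S = p⊆q∧∣q∣≤∣p∣⇒q⊆p (image-∘-⊆ g s)
    (≤-reflexive (trans (proj₂ g-min) (sym (proj₂ (Minimal-∘ʳ g-min s∈S)))))

  Inseparable : Rel (Fin n) ℓ
  Inseparable x y = ∀ {g} → Minimal g → g x ≡ g y

  -- A minimal `g` maps `image f₂` onto its own image, so it sends some point of `T ∪ ⁅ y ⁆` to
  -- `g x`. Injectivity on `image f₁`, which contains `T` and `x`, rules out points of `T`; only `y`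
  -- is left.
  inseparable-apexes : ∀ {f₁ f₂} → Minimal f₁ → Minimal f₂ → ∀ {T x y} →
    T ⊆ image f₁ → x ∈ₛ image f₁ → x ∉ₛ T → image f₂ ⊆ T ∪ ⁅ y ⁆ → Inseparable x y
  inseparable-apexes {f₁} {f₂} f₁-min f₂-min {T} {x} {y} T⊆ x∈ x∉T ⊆T∪y {g} g-min
    with z , gf₂z≡gx ← ∈-image⁻ (g ∘ f₂) (image-⊆-image-∘ g-min (proj₁ f₂-min) (∈-image⁺ g x))
    with x∈p∪q⁻ T ⁅ y ⁆ (⊆T∪y (∈-image⁺ f₂ z))
  ... | inj₁ t∈T = contradiction
    (subst (_∈ₛ T) (injective-on-image (proj₁ g-min) f₁-min (T⊆ t∈T) x∈ gf₂z≡gx) t∈T) x∉T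
  ... | inj₂ t∈y = trans (sym gf₂z≡gx) (cong g (x∈⁅y⁆⇒x≡y y t∈y))

  -- Primitivity and large kernel classes.

  module _ {ℓ′} {G : Pred (Permutation′ n) ℓ′} (isGroup : IsPermutationGroup G)
    (contains : S Contains G) (isPrimitive : Primitive G) (1<r : 1 < r) where

    open Primitive isPrimitive

    image-nonempty : ∀ {g} → Minimal g → Nonempty (image g)
    image-nonempty {g} (_ , refl) =
      let y , y∈ , _ = ∣p∣<∣q∣⇒∃∈∉ ⊥ (image g) (subst (_< rank g) (sym (∣⊥∣≡0 n)) (<-trans (s≤s z≤n) 1<r))
      in y , y∈

    minimal-through : ∀ x → ∃[ g ] (Minimal g × x ∈ₛ image g)
    minimal-through x =
      let f , f-min = attained
          y , y∈ = image-nonempty f-min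
          z , fz≡y = ∈-image⁻ f y∈
          π , π∈G , πy≡x = transitive y x
      in (π ⟨$⟩ʳ_) ∘ f , Minimal-∘ˡ (contains π∈G) f-min ,
         subst (_∈ₛ image ((π ⟨$⟩ʳ_) ∘ f)) (trans (cong (π ⟨$⟩ʳ_) fz≡y) πy≡x) (∈-image⁺ ((π ⟨$⟩ʳ_) ∘ f) z)

    -- The clique is `image g` and the coclique is the fibre: for `π` in `G`, the map `h ∘ π` lies
    -- in `S`, hence is injective on `image g`, so at most one point of `image g` is moved into the
    -- fibre.
    large-fibre⇒∈image : ∀ {h g y} → h ∈ S → Minimal g → r * ∣ fibre h y ∣ ≡ n → y ∈ₛ image (h ∘ g)
    large-fibre⇒∈image {h} {g} {y} h∈S g-min@(g∈S , refl) size =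
      let x , x∈ = clique-coclique isGroup transitive (image g) (fibre h y) size (image-nonempty g-min)
            (λ π∈G x∈K z∈K πx∈A πz∈A → injective-on-image (∘-closed (contains π∈G) h∈S) g-min x∈K z∈K
              (trans (∈-fibre⁻ πx∈A) (sym (∈-fibre⁻ πz∈A))))
          x∈K , x∈A = x∈p∩q⁻ (image g) (fibre h y) x∈
          z , gz≡x = ∈-image⁻ g x∈K
      in subst (_∈ₛ image (h ∘ g)) (trans (cong h gz≡x) (∈-fibre⁻ x∈A)) (∈-image⁺ (h ∘ g) z)
      where
      ∈-fibre⁻ : ∀ {x} → x ∈ₛ fibre h y → h x ≡ y
      ∈-fibre⁻ = ∈-tabulate⁻ (λ x → h x ≟ y)

    inseparable⇒≡ : ∀ {x y} → Inseparable x y → x ≡ y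
    inseparable⇒≡ {x} {y} insep = decidable-stable (x ≟ y) λ x≢y →
      -- The goal is stable, so `Inseparable` may be assumed decidable. Passing to `True` then also
      -- brings it down to the universe level that `no-congruence` expects.
      sequence (RawMonad.rawApplicative ¬¬-Monad) (λ u → ¬¬-decidable (Inseparable u)) λ inseparable? →
      let isDecEquivalence : IsDecEquivalence (λ u v → True (inseparable? u v))
          isDecEquivalence = record
            { isEquivalence = record
              { refl  = λ {u} → fromWitness {a? = inseparable? u u} λ _ → refl
              ; sym   = λ {u} {v} uv → fromWitness {a? = inseparable? v u} λ g-min →
                  sym (toWitness {a? = inseparable? u v} uv g-min)
              ; trans = λ {u} {v} {w} uv vw → fromWitness {a? = inseparable? u w} λ g-min →
                  trans (toWitness {a? = inseparable? u v} uv g-min) (toWitness {a? = inseparable? v w} vw g-min)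
              }
            ; _≟_ = λ u v → map′ (fromWitness {a? = inseparable? u v}) toWitness (inseparable? u v)
            }

          preserved : Preserves G (λ u v → True (inseparable? u v))
          preserved {π} = λ π∈G {u} {v} uv →
            fromWitness {a? = inseparable? (π ⟨$⟩ʳ u) (π ⟨$⟩ʳ v)} λ g-min →
              -- Inseparability of `u` and `v` is applied to `g ∘ π`, which is again minimal.
              toWitness {a? = inseparable? u v} uv (Minimal-∘ʳ g-min (contains π∈G))
      in case no-congruence isDecEquivalence preserved of λ where
        (inj₁ trivial)   → x≢y (trivial (fromWitness {a? = inseparable? x y} insep))
        (inj₂ universal) →
          let f , f-min = attained
          in <⇒≱ (subst (1 <_) (sym (proj₂ f-min)) 1<r)
               (constant⇒rank≤1 f λ u v → toWitness {a? = inseparable? u v} (universal u v) f-min)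

    r<rank⇒few-large-parts : ∀ {h} → h ∈ S → r < rank h → ¬ (r ∸ 1 ≤ numParts-of-size-n/ r h)
    r<rank⇒few-large-parts {h} h∈S r<rank enough =
      let f , f-min = attained
          c₁ , c₁∈h , c₁∉T = ∣p∣<∣q∣⇒∃∈∉ T (image h) (small f-min (T⊆ f-min))
          g₁ , g₁-min , c₁∈g₁ = through c₁∈h
          -- `T ∪ ⁅ c₁ ⁆` lies in the image of the minimal element `h ∘ g₁`, so it has at most `r`
          -- points and misses some value of `h`.
          c₂ , c₂∈h , c₂∉ = ∣p∣<∣q∣⇒∃∈∉ (T ∪ ⁅ c₁ ⁆) (image h) (small g₁-min (∪⁅⁆-⊆ (T⊆ g₁-min) c₁∈g₁))
          g₂ , g₂-min , c₂∈g₂ = through c₂∈h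
      in c₂∉ (subst (_∈ₛ T ∪ ⁅ c₁ ⁆)
           (inseparable⇒≡ (inseparable-apexes (Minimal-∘ˡ h∈S g₁-min) (Minimal-∘ˡ h∈S g₂-min)
             (T⊆ g₁-min) c₁∈g₁ c₁∉T
             -- `T ∪ ⁅ c₂ ⁆` has at least `r` points, so it fills the image of `h ∘ g₂`.
             (p⊆q∧∣q∣≤∣p∣⇒q⊆p (∪⁅⁆-⊆ (T⊆ g₂-min) c₂∈g₂)
               (≤-trans (≤-reflexive (proj₂ (Minimal-∘ˡ h∈S g₂-min)))
                 (≤-trans r≤1+∣T∣ (∣∪⁅⁆∣ (c₂∉ ∘ p⊆p∪q ⁅ c₁ ⁆)))))))
           (q⊆p∪q T ⁅ c₁ ⁆ (x∈⁅x⁆ c₁)))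
      where
      large? : Decidable (λ y → y ∈ₛ image h × r * ∣ fibre h y ∣ ≡ n)
      large? y = (y ∈? image h) ×-dec (r * ∣ fibre h y ∣ ℕ.≟ n)

      T : Subset n
      T = tabulate (does ∘ large?)

      r≤1+∣T∣ : r ≤ suc ∣ T ∣
      r≤1+∣T∣ = ≤-trans (m≤n+m∸n r 1) (s≤s (≤-trans enough (≤-reflexive
        (length-filter-map-filter (λ P → r * ∣ P ∣ ℕ.≟ n) (_∈? image h) (fibre h) (λ y → y)))))

      T⊆ : ∀ {g} → Minimal g → T ⊆ image (h ∘ g)
      T⊆ g-min y∈T = large-fibre⇒∈image h∈S g-min (proj₂ (∈-tabulate⁻ large? y∈T))

      small : ∀ {g p} → Minimal g → p ⊆ image (h ∘ g) → ∣ p ∣ < rank h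
      small g-min p⊆ =
        ≤-<-trans (≤-trans (p⊆q⇒∣p∣≤∣q∣ p⊆) (≤-reflexive (proj₂ (Minimal-∘ˡ h∈S g-min)))) r<rank

      through : ∀ {c} → c ∈ₛ image h → ∃[ g ] (Minimal g × c ∈ₛ image (h ∘ g))
      through c∈ with b , refl ← ∈-image⁻ h c∈ with g , g-min , b∈ ← minimal-through b
        with z , refl ← ∈-image⁻ g b∈ = g , g-min , ∈-image⁺ (h ∘ g) z

theorem12 : ∀ {ℓ ℓ′ : Level} (n : ℕ)
    (S : Pred (Transformation n) ℓ) → IsTransformationSemigroup S →
    (G : Pred (Permutation′ n) ℓ′) → IsPermutationGroup G →
    S Contains G → Primitive G →
    (r : ℕ) → IsMinimumRank S r → 1 < r →
    ¬ (∃[ h ] (h ∈ S × r < rank h × r ∸ 1 ≤ numParts-of-size-n/ r h))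
theorem12 n S isSemigroup G isGroup contains isPrimitive r isMinimumRank 1<r (h , h∈S , r<rank , enough) =
  r<rank⇒few-large-parts isSemigroup isMinimumRank isGroup contains isPrimitive 1<r h∈S r<rank enough
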